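{- There is no tournament $T$ having two distinct minimal $\tau$-retentive sets $R_1$ and $R_2$ with $|R_1|=6$ and $|R_2|\in\{6,7,8\}$.
   Context: A tournament $T$ consists of a finite vertex set $V(T)$ and an asymmetric, complete binary relation $\succ$ on $V(T)$ ($x$ dominates $y$ if $x\succ y$). For $v\in V(T)$ let $N^-_T(v)=\{u\in V(T): u\succ v\}$; for $B\subseteq V(T)$, $T[B]$ is the induced subtournament. The tournament equilibrium set $\tau$ is defined recursively: a nonempty $A\subseteq V(T)$ is $\tau$-retentive if for every $v\in A$ with $N^-_T(v)\neq\emptyset$, $\tau(T[N^-_T(v)])\subseteq A$; $A$ is a minimal $\tau$-retentive set if no $\tau$-retentive set of $T$ is a proper subset of $A$; $\tau(T)$ is the union of all minimal $\tau$-retentive sets of $T$. -}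

module Defs where

open import Data.Nat using (ℕ; zero; suc)
open import Data.Fin using (Fin)
open import Data.Fin.Subset using (Subset; _∈_; _⊆_; _⊂_; _∩_; Nonempty; ⊤)
open import Data.Vec using (tabulate)
open import Data.Product using (Σ; _×_)
open import Data.Sum using (_⊎_)
open import Data.Empty using (⊥)
open import Relation.Nullary using (¬_; Dec; does)
open import Relation.Binary.PropositionalEquality using (_≡_)

record Tournament (n : ℕ) : Set₁ where
  field
    _≻_      : Fin n → Fin n → Set
    dec      : ∀ x y → Dec (x ≻ y)
    asym     : ∀ {x y} → x ≻ y → ¬ (y ≻ x)
    complete : ∀ {x y} → ¬ (x ≡ y) → (x ≻ y) ⊎ (y ≻ x)

module _ {n : ℕ} (T : Tournament n) where
  open Tournament T

  inNbr : Subset n → Fin n → Subset n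
  inNbr B v = B ∩ tabulate (λ u → does (dec u v))

  -- Given an interpretation t of τ on subtournaments (as a subset-valued map),
  -- A is τ-retentive in T[B].
  Retentive : (Subset n → Subset n → Set) → Subset n → Subset n → Set
  Retentive t B A =
    Nonempty A × A ⊆ B ×
    (∀ v → v ∈ A → Nonempty (inNbr B v) → t (inNbr B v) A)

  MinRet : (Subset n → Subset n → Set) → Subset n → Subset n → Set
  MinRet t B A = Retentive t B A × (∀ A′ → Retentive t B A′ → A′ ⊂ A → ⊥)

  -- τ with fuel: τ≤ k B A  means  τ(T[B]) ⊆ A.
  -- τ(T[B]) = union of minimal τ-retentive sets of T[B].
  -- Recursive calls are on in-neighbourhoods, which are strictly smaller, so
  -- fuel k is sufficient for every B with |B| ≤ k.
  τ⊆ : ℕ → Subset n → Subset n → Set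
  τ⊆ zero    B A = ⊥
  τ⊆ (suc k) B A = ∀ x → (Σ (Subset n) λ R → MinRet (τ⊆ k) B R × x ∈ R) → x ∈ A

  MinimalTauRetentive : Subset n → Set
  MinimalTauRetentive A = MinRet (τ⊆ n) ⊤ A

module Submission where

-- Let v ∈ R₂ have in-degree at most 3 inside R₂, and let S be a minimal retentive set of T[N⁻(v)].  Then S ⊆ R₂
-- has at most three elements, so it is a Condorcet winner of N⁻(v) or a 3-cycle each of whose vertices is a
-- Condorcet winner among the dominators of the next one.  Hence there are a, b, c ∈ R₂ such that no vertex
-- dominates v together with two of a, b, c (up to repetition).  As R₁ and R₂ are disjoint, every vertex of R₁ is
-- dominated by v or by at least two of a, b, c.
--
-- On the other side, a chain v₀ ∈ R₁, v₁ ∈ τ(N⁻(v₀)), v₂ ∈ τ(N⁻(v₀) ∩ N⁻(v₁)), … continued until the common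
-- in-neighbourhood is empty stays inside R₁ and has no common dominator.  So the subsets of R₁ dominated by v, a,
-- b, c contain no chain, and running through the tournaments on six vertices shows that four chain-free subsets
-- can never cover R₁ in this way.  Only lower bounds for τ enter the definition of a chain, so uniqueness of
-- minimal retentive sets of subtournaments is never needed.

open import Defs
import Data.Nat.Properties as ℕ
open import Algebra.Properties.CommutativeMonoid.Sum ℕ.+-0-commutativeMonoid
  using (sum; sum-remove; ∑-distrib-+; ∑-comm; sum-cong-≗)
open import Data.Bool using (Bool; true; false; not; if_then_else_; _∧_)
open import Data.Bool.Properties using (∧-conicalˡ; ∧-conicalʳ)
open import Data.Empty using (⊥; ⊥-elim)
open import Data.Fin using (Fin; zero; suc; punchIn)
open import Data.Fin.Patterns using (0F; 1F; 2F; 3F; 4F; 5F)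
open import Data.Fin.Properties using (_≟_; any?; suc-injective; punchInᵢ≢i)
open import Data.Fin.Subset
  using (Subset; _∈_; _∉_; _⊆_; _⊂_; _∩_; _∪_; _-_; ⁅_⁆; ∣_∣; ⊤; Nonempty) renaming (⊥ to ∅)
open import Data.Fin.Subset.Induction using (⊂-wellFounded; Acc; acc)
open import Data.Fin.Subset.Properties
  using (∉⊥; ∈⊤; _∈?_; _⊆?_; nonempty?; x∈⁅x⁆; x∈⁅y⁆⇒x≡y; x∈p∩q⁺; x∈p∩q⁻; x∈p∪q⁺; x∈p∪q⁻; p∩q⊆p; p∩q⊆q;
         p─q⊆p; p─⊥≡p; x∈p∧x≢y⇒x∈p-y; ⊆-antisym; p⊆q⇒∣p∣≤∣q∣; ∣p∣≤n)
open import Data.List using (List; []; _∷_; _++_; map; concatMap; filter; allFin)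
open import Data.List.Membership.Propositional using (find) renaming (_∈_ to _∈ₗ_)
open import Data.List.Membership.Propositional.Properties
  using (∈-map⁺; ∈-map⁻; ∈-++⁺ˡ; ∈-++⁺ʳ; ∈-filter⁺; ∈-filter⁻; ∈-allFin; ∈-concatMap⁻)
open import Data.List.Relation.Unary.All as All using (All)
open import Data.List.Relation.Unary.Any as Any using (Any; here; there)
open import Data.Nat using (ℕ; zero; suc; _+_; _*_; _≤_; _≤?_; z≤n; s≤s)
open import Data.Nat.Properties
  using (≤-refl; ≤-reflexive; ≤-trans; ≤-antisym; ≤-pred; <-irrefl; <-≤-trans; <⇒≱; ≰⇒>; ≮⇒≥; n<1+n; n≤1+n;
         +-suc; +-mono-≤; *-identityʳ; *-monoʳ-<; m≤n⇒∃[o]m+o≡n)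
open import Data.Product using (Σ; ∃; _×_; _,_; proj₁; proj₂)
open import Data.Sum using (_⊎_; inj₁; inj₂; [_,_]′)
open import Data.Vec using (Vec; []; _∷_; lookup; tabulate; here; there)
open import Data.Vec.Properties using (lookup∘tabulate; []=⇒lookup; lookup⇒[]=; tabulate-cong)
open import Function using (_∘_; id)
open import Function.Definitions using (Injective)
open import Relation.Binary.PropositionalEquality
  using (_≡_; _≢_; refl; sym; trans; cong; cong₂; subst; module ≡-Reasoning)
open import Relation.Nullary using (¬_; Dec; does; yes; no; contradiction)
open import Relation.Nullary.Decidable using (_×-dec_; _→-dec_; ¬?; map′; dec-true; dec-false; decidable-stable)
open import Relation.Unary using (Decidable)

private variable k m n : ℕ

-- Chains of a tournament given by its in-neighbourhoods

sweep : Vec (Subset m) m → List (Fin m) → Subset m → Subset m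
sweep g []       X = X
sweep g (a ∷ as) X = sweep g as (if does (a ∈? X) then X ∪ lookup g a else X)

commonReach : Vec (Subset m) m → Subset m → List (Fin m) → Subset m
commonReach         g M []       = M
commonReach {m = m} g M (a ∷ as) =
  if does (a ∈? M)
  then sweep g (allFin m ++ allFin m ++ allFin m) ⁅ a ⁆ ∩ commonReach g M as
  else commonReach g M as

-- A lower bound for τ of the subtournament on M, where I lists the in-neighbourhoods: a minimal retentive set
-- contained in M is closed under a ↦ core (M ∩ I a), hence contains every vertex reachable from all vertices of M.
-- Stopping the closure after three sweeps keeps it a lower bound, strong enough for six vertices.
core : Vec (Subset m) m → ℕ → Subset m → Subset m
core         I zero    M = ∅
core {m = m} I (suc k) M = commonReach (tabulate λ a → core I k (M ∩ lookup I a)) M (allFin m)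

elements : Subset m → List (Fin m)
elements {m = m} X = filter (_∈? X) (allFin m)

-- Running out of fuel yields no chain, which only weakens `ChainFree`.
chains     : Vec (Subset m) m → ℕ → Subset m → List (Subset m)
chainsFrom : Vec (Subset m) m → ℕ → Subset m → Fin m → List (Subset m)
chains I zero    M = []
chains I (suc k) M =
  if does (nonempty? M) then concatMap (chainsFrom I k M) (elements (core I (suc k) M)) else ∅ ∷ []
chainsFrom I k M a = map (⁅ a ⁆ ∪_) (chains I k (M ∩ lookup I a))

-- The first vertex ranges over all vertices and not over a core: in the application they all belong
-- to one minimal retentive set of the whole tournament, so a chain may start at any of them.
allChains : Vec (Subset m) m → ℕ → List (Subset m)
allChains {m = m} I k = concatMap (chainsFrom I k ⊤) (allFin m)

sweep-⊆ : ∀ (g : Vec (Subset m) m) as {X Z} → X ⊆ Z → (∀ {a} → a ∈ Z → lookup g a ⊆ Z) →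
          sweep g as X ⊆ Z
sweep-⊆ g []       X⊆Z closed = X⊆Z
sweep-⊆ g (a ∷ as) {X} {Z} X⊆Z closed with a ∈? X
... | no  _   = sweep-⊆ g as X⊆Z closed
... | yes a∈X = sweep-⊆ g as grow closed
  where
  grow : X ∪ lookup g a ⊆ Z
  grow x∈ with x∈p∪q⁻ X (lookup g a) x∈
  ... | inj₁ x∈X = X⊆Z x∈X
  ... | inj₂ x∈g = closed (X⊆Z a∈X) x∈g

commonReach-⊆ : ∀ (g : Vec (Subset m) m) M as → commonReach g M as ⊆ M
commonReach-⊆ g M []       x∈ = x∈
commonReach-⊆ g M (a ∷ as) x∈ with a ∈? M
... | no  _ = commonReach-⊆ g M as x∈
... | yes _ = commonReach-⊆ g M as (proj₂ (x∈p∩q⁻ _ _ x∈))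

-- One of the intersected sets is swept from `⁅ z ⁆`, and sweeping from inside a closed set never
-- leaves it.
commonReach-⊆-closed : ∀ (g : Vec (Subset m) m) {M Z} as → Z ⊆ M → (∀ {a} → a ∈ Z → lookup g a ⊆ Z) →
                       ∀ {z} → z ∈ Z → z ∈ₗ as → commonReach g M as ⊆ Z
commonReach-⊆-closed g {M} {Z} (a ∷ as) Z⊆M closed {z} z∈Z z∈as x∈ with a ∈? M | z∈as
... | yes _   | here refl = sweep-⊆ g (allFin _ ++ allFin _ ++ allFin _)
                              (λ y∈ → subst (_∈ Z) (sym (x∈⁅y⁆⇒x≡y z y∈)) z∈Z) closed (proj₁ (x∈p∩q⁻ _ _ x∈))
... | yes _   | there z∈  = commonReach-⊆-closed g as Z⊆M closed z∈Z z∈ (proj₂ (x∈p∩q⁻ _ _ x∈))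
... | no  a∉M | here refl = contradiction (Z⊆M z∈Z) a∉M
... | no  _   | there z∈  = commonReach-⊆-closed g as Z⊆M closed z∈Z z∈ x∈

core-⊆ : ∀ (I : Vec (Subset m) m) k M → core I k M ⊆ M
core-⊆ I zero    M x∈ = contradiction x∈ ∉⊥
core-⊆ I (suc k) M x∈ = commonReach-⊆ (tabulate λ a → core I k (M ∩ lookup I a)) M (allFin _) x∈

∈-chainsFrom⁻ : ∀ (I : Vec (Subset m) m) k M a {C} → C ∈ₗ chainsFrom I k M a →
                ∃ λ C′ → C′ ∈ₗ chains I k (M ∩ lookup I a) × a ∈ C × C′ ⊆ C
∈-chainsFrom⁻ I k M a C∈ with ∈-map⁻ (⁅ a ⁆ ∪_) C∈
... | C′ , C′∈ , refl = C′ , C′∈ , x∈p∪q⁺ (inj₁ (x∈⁅x⁆ a)) , λ x∈ → x∈p∪q⁺ (inj₂ x∈)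

∈-concatMap : ∀ {A B : Set} {f : A → List B} {y} xs → y ∈ₗ concatMap f xs →
              ∃ λ x → x ∈ₗ xs × y ∈ₗ f x
∈-concatMap xs y∈ = find (∈-concatMap⁻ _ y∈)

-- Chain-free sets and triple covers

subsets : ∀ m → List (Subset m)
subsets zero    = [] ∷ []
subsets (suc m) = map (true ∷_) (subsets m) ++ map (false ∷_) (subsets m)

∈-subsets : ∀ (P : Subset m) → P ∈ₗ subsets m
∈-subsets []          = here refl
∈-subsets (true  ∷ P) = ∈-++⁺ˡ (∈-map⁺ _ (∈-subsets P))
∈-subsets (false ∷ P) = ∈-++⁺ʳ _ (∈-map⁺ _ (∈-subsets P))

ChainFree : List (Subset m) → Subset m → Set
ChainFree Cs P = All (λ C → ¬ (C ⊆ P)) Cs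

chainFree? : (Cs : List (Subset m)) → Decidable (ChainFree Cs)
chainFree? Cs P = All.all? (λ C → ¬? (C ⊆? P)) Cs

Below : List (Subset m) → Subset m → Set
Below Qs P = Any (P ⊆_) Qs

below? : (Qs : List (Subset m)) → Decidable (Below Qs)
below? Qs P = Any.any? (P ⊆?_) Qs

-- Supersets come first in `subsets`, so on sublists of it only the maximal members survive.
prune : List (Subset m) → List (Subset m) → List (Subset m)
prune []       Qs = Qs
prune (P ∷ Ps) Qs = prune Ps (if does (below? Qs P) then Qs else P ∷ Qs)

Cover : Subset m → Subset m → Subset m → Set
Cover P Q R = ⊤ ⊆ P ∪ Q ∪ R

cover? : (P Q R : Subset m) → Dec (Cover P Q R)
cover? P Q R = ⊤ ⊆? P ∪ Q ∪ R

Cover-mono : ∀ {P Q R P′ Q′ R′ : Subset m} → P ⊆ P′ → Q ⊆ Q′ → R ⊆ R′ → Cover P Q R → Cover P′ Q′ R′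
Cover-mono {P = P} {Q} {R} P⊆ Q⊆ R⊆ cov x∈ with x∈p∪q⁻ P (Q ∪ R) (cov x∈)
... | inj₁ x∈P = x∈p∪q⁺ (inj₁ (P⊆ x∈P))
... | inj₂ x∈QR with x∈p∪q⁻ Q R x∈QR
...   | inj₁ x∈Q = x∈p∪q⁺ (inj₂ (x∈p∪q⁺ (inj₁ (Q⊆ x∈Q))))
...   | inj₂ x∈R = x∈p∪q⁺ (inj₂ (x∈p∪q⁺ (inj₂ (R⊆ x∈R))))

-- The three covers together say that every vertex lies in `P` or in at least two of `A`, `B`, `C`.
-- Asking for `Cover P A B` before `C` is chosen cuts the search short.
NoTripleCover : List (Subset m) → Set
NoTripleCover Qs = All (λ P → All (λ A → All (λ B → Cover P A B →
  All (λ C → Cover P B C → ¬ Cover P A C) Qs) Qs) Qs) Qs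

noTripleCover? : (Qs : List (Subset m)) → Dec (NoTripleCover Qs)
noTripleCover? Qs = All.all? (λ P → All.all? (λ A → All.all? (λ B → cover? P A B →-dec
  All.all? (λ C → cover? P B C →-dec ¬? (cover? P A C)) Qs) Qs) Qs) Qs

-- The first component checks by computation that pruning has lost nothing, which replaces a
-- correctness proof for `prune`.
Unjoinable : List (Subset m) → Set
Unjoinable Ps = All (Below Qs) Ps × NoTripleCover Qs
  where Qs = prune Ps []

unjoinable? : (Ps : List (Subset m)) → Dec (Unjoinable Ps)
unjoinable? {m} Ps = decide (prune Ps [])
  where
  decide : (Qs : List (Subset m)) → Dec (All (Below Qs) Ps × NoTripleCover Qs)
  decide Qs = All.all? (below? Qs) Ps ×-dec noTripleCover? Qs

-- A record, so that type checking never compares the (huge) normal forms of its field type.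
record Resists (I : Vec (Subset m) m) (k : ℕ) : Set where
  constructor resisting
  field unjoinable : Unjoinable (filter (chainFree? (allChains I k)) (subsets m))

resists? : (I : Vec (Subset m) m) (k : ℕ) → Dec (Resists I k)
resists? {m} I k = map′ resisting Resists.unjoinable (unjoinable? (filter (chainFree? (allChains I k)) (subsets m)))

-- Each chain-free set lies below a pruned one and covers are monotone, so four chain-free sets
-- could be replaced by four pruned ones, which the check excludes.
resists : ∀ {I : Vec (Subset m) m} {k} → Resists I k → ∀ {P A B C} →
          ChainFree (allChains I k) P → ChainFree (allChains I k) A →
          ChainFree (allChains I k) B → ChainFree (allChains I k) C →
          Cover P A B → Cover P B C → ¬ Cover P A C
resists {m} {I} {k} (resisting (below , none)) freeP freeA freeB freeC PAB PBC PAC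
  with bound freeP | bound freeA | bound freeB | bound freeC
  where
  bound : ∀ {P} → ChainFree (allChains I k) P →
          ∃ λ Q → Q ∈ₗ prune (filter (chainFree? (allChains I k)) (subsets m)) [] × P ⊆ Q
  bound {P} free = find
    (All.lookup below (∈-filter⁺ (chainFree? (allChains I k)) (∈-subsets P) free))
... | P′ , P′∈ , P⊆ | A′ , A′∈ , A⊆ | B′ , B′∈ , B⊆ | C′ , C′∈ , C⊆ =
  All.lookup (All.lookup (All.lookup (All.lookup none P′∈) A′∈) B′∈ (Cover-mono P⊆ A⊆ B⊆ PAB)) C′∈
    (Cover-mono P⊆ B⊆ C⊆ PBC) (Cover-mono P⊆ A⊆ C⊆ PAC)

-- Exhaustive checks

everyVec : ∀ n → (Vec Bool n → Bool) → Bool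
everyVec zero    f = f []
everyVec (suc n) f = everyVec n (λ v → f (true ∷ v)) ∧ everyVec n (λ v → f (false ∷ v))

everyVec-sound : ∀ n (f : Vec Bool n → Bool) → everyVec n f ≡ true → ∀ v → f v ≡ true
everyVec-sound zero    f eq []          = eq
everyVec-sound (suc n) f eq (true  ∷ v) = everyVec-sound n _ (∧-conicalˡ _ _ eq) v
everyVec-sound (suc n) f eq (false ∷ v) = everyVec-sound n _ (∧-conicalʳ _ _ eq) v

does⇒witness : {P : Set} (P? : Dec P) → does P? ≡ true → P
does⇒witness (yes p) _ = p

-- In-neighbourhoods of the tournaments with 1, 2, 3 ≻ 0 and 1 ≻ 2 ≻ 3; bij says whether i ≻ j.
matrix₆ : Vec Bool 10 → Vec (Subset 6) 6
matrix₆ (b04 ∷ b05 ∷ b13 ∷ b14 ∷ b15 ∷ b24 ∷ b25 ∷ b34 ∷ b35 ∷ b45 ∷ []) =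
  (false ∷ true ∷ true ∷ true ∷ not b04 ∷ not b05 ∷ []) ∷
  (false ∷ false ∷ false ∷ not b13 ∷ not b14 ∷ not b15 ∷ []) ∷
  (false ∷ true ∷ false ∷ false ∷ not b24 ∷ not b25 ∷ []) ∷
  (false ∷ b13 ∷ true ∷ false ∷ not b34 ∷ not b35 ∷ []) ∷
  (b04 ∷ b14 ∷ b24 ∷ b34 ∷ false ∷ not b45 ∷ []) ∷
  (b05 ∷ b15 ∷ b25 ∷ b35 ∷ b45 ∷ false ∷ []) ∷ []

-- `refl` evaluates all 1024 orientations of the ten arcs that the normal form leaves free. Fuel 4
-- admits chains of a first vertex and at most three more.
matrix₆-resists : ∀ v → Resists (matrix₆ v) 4
matrix₆-resists v = does⇒witness (resists? (matrix₆ v) 4)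
  (everyVec-sound 10 (λ v → does (resists? (matrix₆ v) 4)) refl v)

-- Minimal retentive sets

comprehension : {P : Fin n → Set} → Decidable P → Subset n
comprehension P? = tabulate (does ∘ P?)

∈-comprehension⁺ : {P : Fin n → Set} (P? : Decidable P) → ∀ {x} → P x → x ∈ comprehension P?
∈-comprehension⁺ P? {x} Px = lookup⇒[]= x _ (trans (lookup∘tabulate _ x) (dec-true (P? x) Px))

∈-comprehension⁻ : {P : Fin n → Set} (P? : Decidable P) → ∀ {x} → x ∈ comprehension P? → P x
∈-comprehension⁻ P? {x} x∈ with P? x | trans (sym (lookup∘tabulate (does ∘ P?) x)) ([]=⇒lookup x∈)
... | yes Px | _  = Px
... | no  _  | ()

module _ (T : Tournament n) where
  open Tournament T

  ∈-inNbr⁺ : ∀ {B x v} → x ∈ B → x ≻ v → x ∈ inNbr T B v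
  ∈-inNbr⁺ {v = v} x∈B x≻v = x∈p∩q⁺ (x∈B , ∈-comprehension⁺ (λ u → dec u v) x≻v)

  ∈-inNbr⁻ : ∀ {B x v} → x ∈ inNbr T B v → x ∈ B × x ≻ v
  ∈-inNbr⁻ {B} {v = v} x∈ with x∈p∩q⁻ B _ x∈
  ... | x∈B , x∈N = x∈B , ∈-comprehension⁻ (λ u → dec u v) x∈N

  arcs : Vec (Subset n) n
  arcs = tabulate λ v → comprehension (λ u → dec u v)

  ∈-arcs⁺ : ∀ {u v} → u ≻ v → u ∈ lookup arcs v
  ∈-arcs⁺ {u} {v} u≻v =
    subst (u ∈_) (sym (lookup∘tabulate _ v)) (∈-comprehension⁺ (λ u → dec u v) u≻v)

  ∈-arcs⁻ : ∀ {u v} → u ∈ lookup arcs v → u ≻ v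
  ∈-arcs⁻ {u} {v} u∈ = ∈-comprehension⁻ (λ u → dec u v) (subst (u ∈_) (lookup∘tabulate _ v) u∈)

  -- `B` itself is retentive, and descent along `⊂` from it ends in a minimal set. Retentiveness is
  -- not decided here, hence the double negation; it suffices because every use aims at a negation
  -- or at a decidable membership.
  minimalRetentive-exists : ∀ k {B} → Nonempty B → ¬ ¬ ∃ (MinRet T (τ⊆ T (suc k)) B)
  minimalRetentive-exists k {B} B≠∅ none = no-retentive (⊂-wellFounded B) B-retentive
    where
    no-retentive : ∀ {A} → Acc _⊂_ A → ¬ Retentive T (τ⊆ T (suc k)) B A
    no-retentive (acc rec) ret = none (_ , ret , λ A′ ret′ A′⊂A → no-retentive (rec A′⊂A) ret′)
    B-retentive : Retentive T (τ⊆ T (suc k)) B B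
    B-retentive = B≠∅ , id , λ { v _ _ x (R , ((_ , R⊆ , _) , _) , x∈R) → p∩q⊆p _ _ (R⊆ x∈R) }

  minimalRetentive-inNbr : ∀ {k B S v} → MinRet T (τ⊆ T (suc k)) B S → v ∈ S → Nonempty (inNbr T B v) →
                           ∀ {R} → MinRet T (τ⊆ T k) (inNbr T B v) R → R ⊆ S
  minimalRetentive-inNbr ((_ , _ , ret) , _) v∈S ne minR x∈R = ret _ v∈S ne _ (_ , minR , x∈R)

  -- If `x` were common, `R ∩ S` would be retentive, since `R` and `S` both contain the minimal
  -- retentive sets of the in-neighbourhoods of their common vertices. By minimality it would then
  -- equal both.
  minimalRetentive-disjoint : ∀ {k B R S} → MinRet T (τ⊆ T (suc k)) B R → MinRet T (τ⊆ T (suc k)) B S →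
                              R ≢ S → ∀ {x} → x ∈ R → x ∉ S
  minimalRetentive-disjoint {k} {B} {R} {S} minR@((_ , R⊆B , _) , minimalR) minS@(_ , minimalS) R≢S {x} x∈R x∈S =
    R≢S (⊆-antisym (λ r∈R → proj₂ (x∈p∩q⁻ R S (R⊆R∩S r∈R))) (λ s∈S → proj₁ (x∈p∩q⁻ R S (S⊆R∩S s∈S))))
    where
    retentive : Retentive T (τ⊆ T (suc k)) B (R ∩ S)
    retentive = (x , x∈p∩q⁺ (x∈R , x∈S)) , R⊆B ∘ p∩q⊆p R S , λ { v v∈ ne y (Q , minQ , y∈Q) →
      x∈p∩q⁺ ( minimalRetentive-inNbr minR (proj₁ (x∈p∩q⁻ R S v∈)) ne minQ y∈Q
             , minimalRetentive-inNbr minS (proj₂ (x∈p∩q⁻ R S v∈)) ne minQ y∈Q) }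
    R⊆R∩S : R ⊆ R ∩ S
    R⊆R∩S {y} y∈R = decidable-stable (y ∈? R ∩ S) λ y∉ →
      minimalR _ retentive (p∩q⊆p R S , y , y∈R , y∉)
    S⊆R∩S : S ⊆ R ∩ S
    S⊆R∩S {y} y∈S = decidable-stable (y ∈? R ∩ S) λ y∉ →
      minimalS _ retentive (p∩q⊆q R S , y , y∈S , y∉)

-- Chains inside a minimal retentive set

induced : (T : Tournament n) (e : Fin m → Fin n) → Injective _≡_ _≡_ e → Tournament m
induced T e inj = record
  { _≻_      = λ i j → e i ≻ e j
  ; dec      = λ i j → dec (e i) (e j)
  ; asym     = asym
  ; complete = λ i≢j → complete (i≢j ∘ inj)
  } where open Tournament T

record Enumeration (p : Subset n) (k : ℕ) : Set where
  field
    at         : Fin k → Fin n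
    injective  : Injective _≡_ _≡_ at
    at∈        : ∀ i → at i ∈ p
    surjective : ∀ {x} → x ∈ p → ∃ λ i → at i ≡ x

module _ (T : Tournament n) {R : Subset n} (E : Enumeration R m) where
  open Tournament T
  open Enumeration E

  private
    I : Vec (Subset m) m
    I = arcs (induced T at injective)

  -- `M` is the preimage of `D` under `at`, while `D` may reach outside `R`. This links cores and
  -- chains, computed inside `R` alone, to retentive sets of subtournaments of all of `T`.
  Traces : Subset m → Subset n → Set
  Traces M D = (∀ {i} → i ∈ M → at i ∈ D) × (∀ {i} → at i ∈ D → i ∈ M)

  traces-inNbr : ∀ {M D} a → Traces M D → Traces (M ∩ lookup I a) (inNbr T D (at a))
  traces-inNbr {M} {D} a (to , from) = to′ , from′
    where
    H = induced T at injective
    to′ : ∀ {i} → i ∈ M ∩ lookup I a → at i ∈ inNbr T D (at a)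
    to′ i∈ with x∈p∩q⁻ M _ i∈
    ... | i∈M , i∈I = ∈-inNbr⁺ T (to i∈M) (∈-arcs⁻ H i∈I)
    from′ : ∀ {i} → at i ∈ inNbr T D (at a) → i ∈ M ∩ lookup I a
    from′ i∈ with ∈-inNbr⁻ T i∈
    ... | i∈D , i≻a = x∈p∩q⁺ (from i∈D , ∈-arcs⁺ H i≻a)

  -- One step of a chain, at the price of one unit of fuel. The summand `suc j` keeps the remaining
  -- fuel positive, as `minimalRetentive-exists` demands; `+-suc` exposes it.
  retentive-inNbr : ∀ k j {D S a} → MinRet T (τ⊆ T (suc (k + suc j))) D S → at a ∈ S → Nonempty (inNbr T D (at a)) →
          ¬ ¬ (∃ λ S′ → MinRet T (τ⊆ T (k + suc j)) (inNbr T D (at a)) S′ × S′ ⊆ S)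
  retentive-inNbr k j minS a∈S ne none rewrite +-suc k j = minimalRetentive-exists T (k + j) ne
    λ { (S′ , minS′) → none (S′ , minS′ , minimalRetentive-inNbr T minS a∈S ne minS′) }

  -- The indices of `S` form a nonempty subset `Z` of `M`. It is closed under the map used by
  -- `core`: for `a` in `Z`, the in-neighbourhood of `at a` has a minimal retentive set inside `S`,
  -- which contains the smaller core by induction.
  core-⊆-minimalRetentive : ∀ k j {D M S} → MinRet T (τ⊆ T (k + suc j)) D S → S ⊆ R → Traces M D →
                            ∀ {i} → i ∈ core I k M → at i ∈ S
  core-⊆-minimalRetentive zero    j minS S⊆R tr i∈ = contradiction i∈ ∉⊥
  core-⊆-minimalRetentive (suc k) j {D} {M} {S} minS@(((s , s∈S) , S⊆D , _) , _) S⊆R tr@(to , from) i∈ =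
    ∈-comprehension⁻ inS? (commonReach-⊆-closed _ (allFin m) Z⊆M closed z∈Z (∈-allFin _) i∈)
    where
    inS? : Decidable (λ i → at i ∈ S)
    inS? i = at i ∈? S
    Z : Subset m
    Z = comprehension inS?
    Z⊆M : Z ⊆ M
    Z⊆M z∈Z = from (S⊆D (∈-comprehension⁻ inS? z∈Z))
    z∈Z : proj₁ (surjective (S⊆R s∈S)) ∈ Z
    z∈Z = ∈-comprehension⁺ inS? (subst (_∈ S) (sym (proj₂ (surjective (S⊆R s∈S)))) s∈S)
    closed : ∀ {a} → a ∈ Z → lookup (tabulate λ a → core I k (M ∩ lookup I a)) a ⊆ Z
    closed {a} a∈Z {b} b∈ = ∈-comprehension⁺ inS? (decidable-stable (inS? b) λ b∉S →
      -- `at b` itself shows that the in-neighbourhood is nonempty, because the core is part of its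
      -- trace.
      retentive-inNbr k j minS a∈S (at b , proj₁ tr′ (core-⊆ I k _ b∈core)) λ { (S′ , minS′ , S′⊆S) →
      b∉S (S′⊆S (core-⊆-minimalRetentive k j minS′ (S⊆R ∘ S′⊆S) tr′ b∈core)) })
      where
      a∈S : at a ∈ S
      a∈S = ∈-comprehension⁻ inS? a∈Z
      tr′ = traces-inNbr {M} {D} a tr
      b∈core : b ∈ core I k (M ∩ lookup I a)
      b∈core = subst (b ∈_) (lookup∘tabulate _ a) b∈

  -- A common dominator `x` survives in every in-neighbourhood along the chain, so each step finds a
  -- further minimal retentive set inside `R`. At the end of the chain `M` is empty, yet the last
  -- such set has indices in `M`.
  chain-undominated : ∀ k j {D M S C x} → MinRet T (τ⊆ T (k + suc j)) D S → S ⊆ R → Traces M D →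
                      C ∈ₗ chains I k M → x ∈ D → ¬ (∀ {i} → i ∈ C → x ≻ at i)
  chain-undominated (suc k) j {D} {M} {S} {C} {x} minS@(((s , s∈S) , S⊆D , _) , _) S⊆R tr@(_ , from) C∈ x∈D x≻C
    with nonempty? M
  ... | no M=∅ with surjective (S⊆R s∈S)
  ...   | i , refl = M=∅ (i , from (S⊆D s∈S))
  chain-undominated (suc k) j {D} {M} {S} {C} {x} minS S⊆R tr C∈ x∈D x≻C | yes _
    with ∈-concatMap (elements (core I (suc k) M)) C∈
  ... | a , a∈ , C∈a with ∈-chainsFrom⁻ I k M a C∈a
  ...   | C′ , C′∈ , a∈C , C′⊆C = retentive-inNbr k j minS a∈S (x , x∈N) λ { (S′ , minS′ , S′⊆S) →
    chain-undominated k j minS′ (S⊆R ∘ S′⊆S) (traces-inNbr {M} {D} a tr) C′∈ x∈N (x≻C ∘ C′⊆C) }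
    where
    a∈S : at a ∈ S
    a∈S = core-⊆-minimalRetentive (suc k) j minS S⊆R tr
            (proj₂ (∈-filter⁻ (_∈? core I (suc k) M) {xs = allFin m} a∈))
    x∈N : x ∈ inNbr T D (at a)
    x∈N = ∈-inNbr⁺ T x∈D (x≻C a∈C)

  dominated : Fin n → Subset m
  dominated x = comprehension λ i → dec x (at i)

  dominated-chainFree : ∀ k j → MinRet T (τ⊆ T (suc (k + suc j))) ⊤ R → ∀ x →
                        ChainFree (allChains I k) (dominated x)
  dominated-chainFree k j minR x = All.tabulate λ {C} C∈ C⊆ → free C∈ C⊆
    where
    free : ∀ {C} → C ∈ₗ allChains I k → ¬ (C ⊆ dominated x)
    free C∈ C⊆ with ∈-concatMap (allFin m) C∈
    ... | a , _ , C∈a with ∈-chainsFrom⁻ I k ⊤ a C∈a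
    ...   | C′ , C′∈ , a∈C , C′⊆C = retentive-inNbr k j minR (at∈ a) (x , x∈N) λ { (S , minS , S⊆R) →
      chain-undominated k j minS S⊆R (traces-inNbr {⊤} {⊤} a ((λ _ → ∈⊤) , (λ _ → ∈⊤))) C′∈ x∈N
        (x≻ ∘ C⊆ ∘ C′⊆C) }
      where
      x≻ : ∀ {i} → i ∈ dominated x → x ≻ at i
      x≻ = ∈-comprehension⁻ (λ i → dec x (at i))
      x∈N : x ∈ inNbr T ⊤ (at a)
      x∈N = ∈-inNbr⁺ T ∈⊤ (x≻ (C⊆ a∈C))

-- Degrees and enumerations

-- Only the values `U i j` with i < j are read, so for concrete `m` an orientation computes to a
-- matrix of independent bits.
entry : (Fin m → Fin m → Bool) → Fin m → Fin m → Bool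
entry U zero    zero    = false
entry U zero    (suc j) = U zero (suc j)
entry U (suc i) zero    = not (U zero (suc i))
entry U (suc i) (suc j) = entry (λ a b → U (suc a) (suc b)) i j

orientation : (Fin m → Fin m → Bool) → Vec (Subset m) m
orientation U = tabulate λ v → tabulate λ u → entry U u v

≡-entry : (U : Fin m → Fin m → Bool) → (∀ i → U i i ≡ false) → (∀ {i j} → i ≢ j → U j i ≡ not (U i j)) →
          ∀ i j → U i j ≡ entry U i j
≡-entry U irr anti zero    zero    = irr zero
≡-entry U irr anti zero    (suc j) = refl
≡-entry U irr anti (suc i) zero    = anti λ ()
≡-entry U irr anti (suc i) (suc j) =
  ≡-entry (λ a b → U (suc a) (suc b)) (irr ∘ suc) (λ i≢j → anti (i≢j ∘ suc-injective)) i j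

module _ (T : Tournament n) where
  open Tournament T

  arc : Fin n → Fin n → Bool
  arc u v = does (dec u v)

  arc-true : ∀ {u v} → u ≻ v → arc u v ≡ true
  arc-true {u} {v} u≻v = dec-true (dec u v) u≻v

  arc-false : ∀ {u v} → v ≻ u → arc u v ≡ false
  arc-false {u} {v} v≻u = dec-false (dec u v) (asym v≻u)

  irreflexive : ∀ {v} → ¬ (v ≻ v)
  irreflexive v≻v = asym v≻v v≻v

  arc-irreflexive : ∀ v → arc v v ≡ false
  arc-irreflexive v = dec-false (dec v v) irreflexive

  arc-antisymmetric : ∀ {u v} → u ≢ v → arc v u ≡ not (arc u v)
  arc-antisymmetric u≢v with complete u≢v
  ... | inj₁ u≻v = trans (arc-false u≻v) (cong not (sym (arc-true u≻v)))
  ... | inj₂ v≻u = trans (arc-true v≻u) (cong not (sym (arc-false v≻u)))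

  arcs-orientation : arcs T ≡ orientation arc
  arcs-orientation = tabulate-cong λ v → tabulate-cong λ u → ≡-entry arc arc-irreflexive arc-antisymmetric u v

  inDegree : Fin n → ℕ
  inDegree v = ∣ lookup (arcs T) v ∣

indicator : Bool → ℕ
indicator b = if b then 1 else 0

∣tabulate∣ : (f : Fin n → Bool) → ∣ tabulate f ∣ ≡ sum (indicator ∘ f)
∣tabulate∣ {zero}  f = refl
∣tabulate∣ {suc n} f with f zero
... | true  = cong suc (∣tabulate∣ (f ∘ suc))
... | false = ∣tabulate∣ (f ∘ suc)

sum-≤ : (f : Fin n → ℕ) {c : ℕ} → (∀ i → f i ≤ c) → sum f ≤ n * c
sum-≤ {zero}  f f≤ = z≤n
sum-≤ {suc n} f f≤ = +-mono-≤ (f≤ zero) (sum-≤ (f ∘ suc) (f≤ ∘ suc))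

sum-≥ : (f : Fin n → ℕ) {c : ℕ} → (∀ i → c ≤ f i) → n * c ≤ sum f
sum-≥ {zero}  f f≥ = z≤n
sum-≥ {suc n} f f≥ = +-mono-≤ (f≥ zero) (sum-≥ (f ∘ suc) (f≥ ∘ suc))

sum-const : (f : Fin n → ℕ) {c : ℕ} → (∀ i → f i ≡ c) → sum f ≡ n * c
sum-const f f≡ = ≤-antisym (sum-≤ f (≤-reflexive ∘ f≡)) (sum-≥ f (≤-reflexive ∘ sym ∘ f≡))

module _ (T : Tournament (suc k)) where
  private
    d : Fin (suc k) → Fin (suc k) → ℕ
    d u v = indicator (arc T u v)

    inDegree-sum : ∀ v → inDegree T v ≡ sum (λ u → d u v)
    inDegree-sum v = trans (cong ∣_∣ (lookup∘tabulate (λ v → comprehension (λ u → Tournament.dec T u v)) v)) (∣tabulate∣ (λ u → arc T u v))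

    in+out : ∀ v → sum (λ u → d u v + d v u) ≡ k
    in+out v = begin
      sum t                                     ≡⟨ sum-remove {i = v} t ⟩
      t v + sum (t ∘ punchIn v)                 ≡⟨ cong₂ _+_ tv≡0 (sum-const (t ∘ punchIn v) others) ⟩
      k * 1                                     ≡⟨ *-identityʳ k ⟩
      k                                         ∎
      where
      open ≡-Reasoning
      t : Fin (suc k) → ℕ
      t u = d u v + d v u
      tv≡0 : t v ≡ 0
      tv≡0 rewrite arc-irreflexive T v = refl
      others : ∀ j → t (punchIn v j) ≡ 1
      others j rewrite arc-antisymmetric T (punchInᵢ≢i v j ∘ sym) with arc T v (punchIn v j)
      ... | true  = refl
      ... | false = refl

  -- Exchanging the order of summation turns one copy of the in-degrees into out-degrees, and
  -- in-degree plus out-degree is `k` at every vertex.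
  degree-sum : sum (λ v → inDegree T v + inDegree T v) ≡ suc k * k
  degree-sum = begin
    sum (λ v → inDegree T v + inDegree T v)                   ≡⟨ ∑-distrib-+ (inDegree T) (inDegree T) ⟩
    sum (inDegree T) + sum (inDegree T)                       ≡⟨ cong₂ _+_ in≡ (trans in≡ (∑-comm (λ v u → d u v))) ⟩
    sum (λ v → sum (λ u → d u v)) + sum (λ v → sum (λ u → d v u))
                                                              ≡⟨ ∑-distrib-+ (λ v → sum (λ u → d u v)) (λ v → sum (λ u → d v u)) ⟨
    sum (λ v → sum (λ u → d u v) + sum (λ u → d v u))         ≡⟨ sum-const _ (λ v →
      trans (sym (∑-distrib-+ (λ u → d u v) (λ u → d v u))) (in+out v)) ⟩
    suc k * k                                                 ∎
    where
    open ≡-Reasoning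
    in≡ : sum (inDegree T) ≡ sum (λ v → sum (λ u → d u v))
    in≡ = sum-cong-≗ inDegree-sum

  -- By `degree-sum`, twice the in-degree has average `k`; `large-inDegree` is the other half of
  -- this averaging.
  small-inDegree : ∃ λ v → inDegree T v + inDegree T v ≤ k
  small-inDegree = decidable-stable (any? λ v → inDegree T v + inDegree T v ≤? k) λ none →
    <-irrefl refl (<-≤-trans (*-monoʳ-< (suc k) (n<1+n k))
      (≤-trans (sum-≥ _ λ v → ≰⇒> λ le → none (v , le)) (≤-reflexive degree-sum)))

large-inDegree : (T : Tournament (suc k)) → ∃ λ v → k ≤ inDegree T v + inDegree T v
large-inDegree {zero}  T = zero , z≤n
large-inDegree {suc k} T = decidable-stable (any? λ v → suc k ≤? inDegree T v + inDegree T v) λ none →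
  <-irrefl refl (<-≤-trans (*-monoʳ-< (suc (suc k)) (n<1+n k))
    (≤-trans (≤-reflexive (sym (degree-sum T))) (sum-≤ _ λ v → ≤-pred (≰⇒> λ le → none (v , le)))))

enumerate : (p : Subset n) → Enumeration p ∣ p ∣
enumerate []          = record { at = λ () ; injective = λ { {()} } ; at∈ = λ () ; surjective = λ () }
enumerate (false ∷ p) = record
  { at         = suc ∘ at
  ; injective  = injective ∘ suc-injective
  ; at∈        = λ i → there (at∈ i)
  ; surjective = λ { (there x∈p) → let i , eq = surjective x∈p in i , cong suc eq }
  } where open Enumeration (enumerate p)
enumerate (true ∷ p)  = record
  { at         = λ { zero → zero ; (suc i) → suc (at i) }
  ; injective  = λ { {zero} {zero} _ → refl ; {suc i} {suc j} eq → cong suc (injective (suc-injective eq)) }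
  ; at∈        = λ { zero → here ; (suc i) → there (at∈ i) }
  ; surjective = λ { here → zero , refl ; (there x∈p) → let i , eq = surjective x∈p in suc i , cong suc eq }
  } where open Enumeration (enumerate p)

x∉p-x : ∀ {p : Subset n} {x} → x ∉ p - x
x∉p-x {p = _ ∷ p} {suc x} (there x∈) = x∉p-x {p = p} x∈
x∉p-x {p = _ ∷ p} {zero}  ()

∣p∣≡1+∣p-x∣ : ∀ {p : Subset n} {x} → x ∈ p → ∣ p ∣ ≡ suc ∣ p - x ∣
∣p∣≡1+∣p-x∣ {p = _ ∷ p}     here        = cong (suc ∘ ∣_∣) (sym (p─⊥≡p p))
∣p∣≡1+∣p-x∣ {p = true  ∷ p} (there x∈p) = cong suc (∣p∣≡1+∣p-x∣ x∈p)
∣p∣≡1+∣p-x∣ {p = false ∷ p} (there x∈p) = ∣p∣≡1+∣p-x∣ x∈p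

cons : ∀ {p : Subset n} {x} → x ∈ p → Enumeration (p - x) k → Enumeration p (suc k)
cons {p = p} {x} x∈p E = record
  { at         = at′
  ; injective  = inj _ _
  ; at∈        = λ { zero → x∈p ; (suc i) → p─q⊆p p _ (at∈ i) }
  ; surjective = surj
  }
  where
  open Enumeration E
  at′ : Fin (suc _) → Fin _
  at′ zero    = x
  at′ (suc i) = at i
  x≢at : ∀ i → x ≢ at i
  x≢at i x≡ = x∉p-x {p = p} (subst (_∈ p - x) (sym x≡) (at∈ i))
  inj : ∀ i j → at′ i ≡ at′ j → i ≡ j
  inj zero    zero    _  = refl
  inj zero    (suc j) eq = contradiction eq (x≢at j)
  inj (suc i) zero    eq = contradiction (sym eq) (x≢at i)
  inj (suc i) (suc j) eq = cong suc (injective eq)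
  surj : ∀ {y} → y ∈ p → ∃ λ i → at′ i ≡ y
  surj {y} y∈p with x ≟ y
  ... | yes x≡y = zero , x≡y
  ... | no  x≢y = let i , eq = surjective (x∈p∧x≢y⇒x∈p-y y∈p (x≢y ∘ sym)) in suc i , eq

restrict : ∀ {P : Subset m} {Q R : Subset n} (E : Enumeration R m) → Enumeration P k →
           let open Enumeration E in
           (∀ {i} → i ∈ P → at i ∈ Q) → Q ⊆ R → (∀ {i} → at i ∈ Q → i ∈ P) → Enumeration Q k
restrict {Q = Q} E F P→Q Q⊆R Q→P = record
  { at         = E.at ∘ F.at
  ; injective  = F.injective ∘ E.injective
  ; at∈        = P→Q ∘ F.at∈
  ; surjective = surj
  }
  where
  module E = Enumeration E
  module F = Enumeration F
  surj : ∀ {x} → x ∈ Q → ∃ λ i → E.at (F.at i) ≡ x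
  surj x∈Q with E.surjective (Q⊆R x∈Q)
  ... | i , refl with F.surjective (Q→P x∈Q)
  ...   | j , refl = j , refl

-- Normal form of tournaments on six vertices

orientation-matrix₆ : (U : Fin 6 → Fin 6 → Bool) →
  U 0F 1F ≡ false → U 0F 2F ≡ false → U 0F 3F ≡ false → U 1F 2F ≡ true → U 2F 3F ≡ true →
  orientation U ≡ matrix₆ (U 0F 4F ∷ U 0F 5F ∷ U 1F 3F ∷ U 1F 4F ∷ U 1F 5F ∷
                           U 2F 4F ∷ U 2F 5F ∷ U 3F 4F ∷ U 3F 5F ∷ U 4F 5F ∷ [])
orientation-matrix₆ U p q r s t rewrite p | q | r | s | t = refl

module _ (T : Tournament 6) where
  open Tournament T

  arcs-resist : 1F ≻ 0F → 2F ≻ 0F → 3F ≻ 0F → 1F ≻ 2F → 2F ≻ 3F → Resists (arcs T) 4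
  arcs-resist p q r s t = subst (λ I → Resists I 4) (sym (trans (arcs-orientation T)
    (orientation-matrix₆ (arc T) (arc-false T p) (arc-false T q) (arc-false T r) (arc-true T s) (arc-true T t))))
    (matrix₆-resists _)

-- Any three in-neighbours of `v` can be ordered as a directed path, whether they are transitive or
-- cyclic. The arc between `x` and `z` stays open and becomes the bit `b13` of `matrix₆`.
record PathInto {n} (T : Tournament n) (v : Fin n) : Set where
  constructor pathInto
  open Tournament T
  field
    {x y z} : Fin n
    x≻v : x ≻ v
    y≻v : y ≻ v
    z≻v : z ≻ v
    x≻y : x ≻ y
    y≻z : y ≻ z
    x≢z : x ≢ z

module _ (T : Tournament n) where
  open Tournament T

  ≻⇒≢ : ∀ {u v} → u ≻ v → u ≢ v
  ≻⇒≢ u≻v refl = irreflexive T u≻v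

  sort₃ : ∀ {v a b c} → a ≻ v → b ≻ v → c ≻ v → a ≢ b → b ≢ c → a ≢ c → PathInto T v
  sort₃ a≻v b≻v c≻v a≢b b≢c a≢c with complete a≢b | complete b≢c | complete a≢c
  ... | inj₁ a≻b | inj₁ b≻c | _        = pathInto a≻v b≻v c≻v a≻b b≻c a≢c
  ... | inj₁ a≻b | inj₂ c≻b | inj₁ a≻c = pathInto a≻v c≻v b≻v a≻c c≻b a≢b
  ... | inj₁ a≻b | inj₂ c≻b | inj₂ c≻a = pathInto c≻v a≻v b≻v c≻a a≻b (b≢c ∘ sym)
  ... | inj₂ b≻a | inj₂ c≻b | _        = pathInto c≻v b≻v a≻v c≻b b≻a (a≢c ∘ sym)
  ... | inj₂ b≻a | inj₁ b≻c | inj₁ a≻c = pathInto b≻v a≻v c≻v b≻a a≻c b≢c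
  ... | inj₂ b≻a | inj₁ b≻c | inj₂ c≻a = pathInto b≻v c≻v a≻v b≻c c≻a (a≢b ∘ sym)

  inDegree≥3⇒pathInto : ∀ v → 3 ≤ inDegree T v → PathInto T v
  inDegree≥3⇒pathInto v 3≤ with ∣ lookup (arcs T) v ∣ | enumerate (lookup (arcs T) v) | 3≤
  ... | _ | E | s≤s (s≤s (s≤s _)) =
    sort₃ (∈-arcs⁻ T (at∈ 0F)) (∈-arcs⁻ T (at∈ 1F)) (∈-arcs⁻ T (at∈ 2F)) (distinct λ ()) (distinct λ ()) (distinct λ ())
    where
    open Enumeration E
    distinct : ∀ {i j} → i ≢ j → at i ≢ at j
    distinct i≢j eq = i≢j (injective eq)

-- Some vertex has twice its in-degree at least 5, so in-degree at least 3. It and a path of its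
-- in-neighbours take the labels 0 to 3; the other two vertices follow in any order.
resisting-relabelling : (T : Tournament 6) → ∃ λ (E : Enumeration {6} ⊤ 6) →
  Resists (arcs (induced T (Enumeration.at E) (Enumeration.injective E))) 4
resisting-relabelling T = E , arcs-resist (induced T (Enumeration.at E) (Enumeration.injective E)) x≻v y≻v z≻v x≻y y≻z
  where
  open Tournament T
  v,5≤ = large-inDegree T
  v = proj₁ v,5≤
  3≤inDegree : 3 ≤ inDegree T v
  3≤inDegree = ≰⇒> λ le → <⇒≱ (s≤s (+-mono-≤ le le)) (proj₂ v,5≤)
  open PathInto (inDegree≥3⇒pathInto T v 3≤inDegree)
  v∈ : v ∈ ⊤
  v∈ = ∈⊤
  x∈ : x ∈ ⊤ - v
  x∈ = x∈p∧x≢y⇒x∈p-y ∈⊤ (≻⇒≢ T x≻v)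
  y∈ : y ∈ ⊤ - v - x
  y∈ = x∈p∧x≢y⇒x∈p-y (x∈p∧x≢y⇒x∈p-y ∈⊤ (≻⇒≢ T y≻v)) (≻⇒≢ T x≻y ∘ sym)
  z∈ : z ∈ ⊤ - v - x - y
  z∈ = x∈p∧x≢y⇒x∈p-y (x∈p∧x≢y⇒x∈p-y (x∈p∧x≢y⇒x∈p-y ∈⊤ (≻⇒≢ T z≻v)) (x≢z ∘ sym)) (≻⇒≢ T y≻z ∘ sym)
  size : ∣ ⊤ - v - x - y - z ∣ ≡ 2
  size = suc-inj (suc-inj (suc-inj (suc-inj (sym (begin
    6                                              ≡⟨ ∣p∣≡1+∣p-x∣ v∈ ⟩
    suc ∣ ⊤ - v ∣                                  ≡⟨ cong suc (∣p∣≡1+∣p-x∣ x∈) ⟩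
    2 + ∣ ⊤ - v - x ∣                              ≡⟨ cong (2 +_) (∣p∣≡1+∣p-x∣ y∈) ⟩
    3 + ∣ ⊤ - v - x - y ∣                          ≡⟨ cong (3 +_) (∣p∣≡1+∣p-x∣ z∈) ⟩
    4 + ∣ ⊤ - v - x - y - z ∣                      ∎)))))
    where open ≡-Reasoning
          suc-inj = ℕ.suc-injective
  E : Enumeration {6} ⊤ 6
  E = cons v∈ (cons x∈ (cons y∈ (cons z∈ (subst (Enumeration _) size (enumerate (⊤ - v - x - y - z))))))

-- Triads in R₂

-- This and the next type are records for the same reason as `Resists`.
record PairBlocks (I : Vec (Subset m) m) (k : ℕ) (a b : Fin m) : Set where
  constructor pairBlocks
  field chain-⊆ : Any (_⊆ ⁅ a ⁆ ∪ ⁅ b ⁆) (chains I k ⊤)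

record HasTriad (I : Vec (Subset m) m) (k : ℕ) : Set where
  constructor hasTriad
  field
    {a b c} : Fin m
    ab : PairBlocks I k a b
    bc : PairBlocks I k b c
    ac : PairBlocks I k a c

hasTriad? : (I : Vec (Subset m) m) (k : ℕ) → Dec (HasTriad I k)
hasTriad? I k = map′ (λ { (_ , _ , _ , ab , bc , ac) → hasTriad ab bc ac })
                     (λ { (hasTriad ab bc ac) → _ , _ , _ , ab , bc , ac })
                     (any? λ a → any? λ b → any? λ c → blocks? a b ×-dec blocks? b c ×-dec blocks? a c)
  where
  blocks? : ∀ a b → Dec (PairBlocks I k a b)
  blocks? a b = map′ pairBlocks PairBlocks.chain-⊆ (Any.any? (_⊆? ⁅ a ⁆ ∪ ⁅ b ⁆) (chains I k ⊤))

matrix₁ : Vec Bool 0 → Vec (Subset 1) 1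
matrix₁ [] = (false ∷ []) ∷ []

matrix₂ : Vec Bool 1 → Vec (Subset 2) 2
matrix₂ (b ∷ []) = (false ∷ not b ∷ []) ∷ (b ∷ false ∷ []) ∷ []

matrix₃ : Vec Bool 3 → Vec (Subset 3) 3
matrix₃ (b01 ∷ b02 ∷ b12 ∷ []) =
  (false ∷ not b01 ∷ not b02 ∷ []) ∷
  (b01 ∷ false ∷ not b12 ∷ []) ∷
  (b02 ∷ b12 ∷ false ∷ []) ∷ []

matrix₁-triad : ∀ v → HasTriad (matrix₁ v) 4
matrix₁-triad v = does⇒witness (hasTriad? (matrix₁ v) 4)
  (everyVec-sound 0 (λ v → does (hasTriad? (matrix₁ v) 4)) refl v)

matrix₂-triad : ∀ v → HasTriad (matrix₂ v) 4
matrix₂-triad v = does⇒witness (hasTriad? (matrix₂ v) 4)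
  (everyVec-sound 1 (λ v → does (hasTriad? (matrix₂ v) 4)) refl v)

matrix₃-triad : ∀ v → HasTriad (matrix₃ v) 4
matrix₃-triad v = does⇒witness (hasTriad? (matrix₃ v) 4)
  (everyVec-sound 3 (λ v → does (hasTriad? (matrix₃ v) 4)) refl v)

-- With at most three vertices there is either a Condorcet winner, which repeated three times is a
-- triad, or a 3-cycle, where each vertex together with its dominator is a chain.
arcs-triad : (T : Tournament (suc m)) → m ≤ 2 → HasTriad (arcs T) 4
arcs-triad {m} T m≤2 = subst (λ I → HasTriad I 4) (sym (arcs-orientation T)) (go m m≤2 (arc T))
  where
  go : ∀ m → m ≤ 2 → (U : Fin (suc m) → Fin (suc m) → Bool) → HasTriad (orientation U) 4
  go 0 _ U = matrix₁-triad []
  go 1 _ U = matrix₂-triad (U 0F 1F ∷ [])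
  go 2 _ U = matrix₃-triad (U 0F 1F ∷ U 0F 2F ∷ U 1F 2F ∷ [])
  go (suc (suc (suc _))) (s≤s (s≤s ())) _

module _ (T : Tournament n) where
  open Tournament T

  Undominated₃ : Fin n → Fin n → Fin n → Set
  Undominated₃ v a b = ∀ x → x ≻ v → x ≻ a → ¬ (x ≻ b)

  UndominatedTriad : Subset n → Set
  UndominatedTriad R = Σ (Fin n × Fin n × Fin n × Fin n) λ { (v , a , b , c) →
    (v ∈ R × a ∈ R × b ∈ R × c ∈ R) × Undominated₃ v a b × Undominated₃ v b c × Undominated₃ v a c }

  -- A vertex dominating `v` and both members of the pair would lie in the in-neighbourhood of `v`
  -- and dominate a chain of `S`. Here `S` itself is enumerated, so the full index set traces that
  -- in-neighbourhood.
  pair-undominated : ∀ k j {S v} (E : Enumeration S m) → let open Enumeration E in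
    MinRet T (τ⊆ T (k + suc j)) (inNbr T ⊤ v) S →
    ∀ {a b} → PairBlocks (arcs (induced T at injective)) k a b → Undominated₃ v (at a) (at b)
  pair-undominated k j E minS@((_ , S⊆N , _) , _) {a} {b} (pairBlocks C⊆ab) x x≻v x≻a x≻b with find C⊆ab
  ... | C , C∈ , C⊆ = chain-undominated T E k j minS id ((λ {i} _ → S⊆N (at∈ i)) , (λ _ → ∈⊤)) C∈
                        (∈-inNbr⁺ T ∈⊤ x≻v) x≻C
    where
    open Enumeration E
    x≻C : ∀ {i} → i ∈ C → x ≻ at i
    x≻C i∈C with x∈p∪q⁻ ⁅ a ⁆ ⁅ b ⁆ (C⊆ i∈C)
    ... | inj₁ i∈a = subst (λ i → x ≻ at i) (sym (x∈⁅y⁆⇒x≡y a i∈a)) x≻a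
    ... | inj₂ i∈b = subst (λ i → x ≻ at i) (sym (x∈⁅y⁆⇒x≡y b i∈b)) x≻b

  -- The fuel f is kept a variable until the end: with a numeral, `with` unfolds all levels of τ⊆.
  undominatedTriad-inNbr : ∀ f j → f ≡ 4 → ∀ {R S v} → v ∈ R → S ⊆ R →
    MinRet T (τ⊆ T (f + suc j)) (inNbr T ⊤ v) S → Enumeration S k → k ≤ 3 → UndominatedTriad R
  undominatedTriad-inNbr {k = zero} f j f≡4 v∈R S⊆R (((s , s∈S) , _) , _) E _ with Enumeration.surjective E s∈S
  ... | () , _
  undominatedTriad-inNbr {k = suc k} f j f≡4 {R} {S} {v} v∈R S⊆R minS E (s≤s k≤2) =
    (v , at a , at b , at c) , (v∈R , S⊆R (at∈ a) , S⊆R (at∈ b) , S⊆R (at∈ c)) ,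
    pair-undominated f j E minS ab , pair-undominated f j E minS bc , pair-undominated f j E minS ac
    where
    open Enumeration E
    open HasTriad (subst (HasTriad _) (sym f≡4) (arcs-triad (induced T at injective) k≤2))

  undominatedTriad : ∀ f j → f ≡ 4 → ∀ {R} → MinRet T (τ⊆ T (suc (f + suc j))) ⊤ R → Enumeration R (suc k) → k ≤ 7 →
                     ¬ ¬ UndominatedTriad R
  undominatedTriad {k} f j f≡4 {R} minR E k≤7 none
    with small-inDegree (induced T (Enumeration.at E) (Enumeration.injective E))
  ... | i , 2deg≤k with nonempty? (inNbr T ⊤ (Enumeration.at E i))
  ...   | no  N=∅ = none ((v , v , v , v) , (v∈R , v∈R , v∈R , v∈R) , un , un , un)
    where
    v = Enumeration.at E i
    v∈R : v ∈ R
    v∈R = Enumeration.at∈ E i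
    un : Undominated₃ v v v
    un x x≻v _ _ = N=∅ (x , ∈-inNbr⁺ T ∈⊤ x≻v)
  ...   | yes N≠∅ = retentive-inNbr T E f j minR (at∈ i) N≠∅ λ { (S , minS@((_ , S⊆N , _) , _) , S⊆R) →
    let
      inS? : Decidable (λ l → at l ∈ S)
      inS? l = at l ∈? S
      Z = comprehension inS?
      -- `S` belongs to the in-neighbourhood in all of `T`, but it lies in `R`, so its size is
      -- bounded by the in-degree of `i` inside `R`.
      Z⊆arcs : Z ⊆ lookup (arcs H) i
      Z⊆arcs z∈ = ∈-arcs⁺ H (proj₂ (∈-inNbr⁻ T {⊤} (S⊆N (∈-comprehension⁻ inS? z∈))))
    in none (undominatedTriad-inNbr f j f≡4 (at∈ i) S⊆R minS
         (restrict E (enumerate Z) (∈-comprehension⁻ inS?) S⊆R (∈-comprehension⁺ inS?))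
         (≤-trans (p⊆q⇒∣p∣≤∣q∣ Z⊆arcs) deg≤3)) }
    where
    open Enumeration E
    H = induced T at injective
    deg≤3 : inDegree H i ≤ 3
    -- In-degree 4 would give 8 ≤ `k`; this is where the bound 8 on the size of the second set
    -- enters.
    deg≤3 = ≮⇒≥ λ 4≤ → <⇒≱ (s≤s k≤7) (≤-trans (+-mono-≤ 4≤ 4≤) 2deg≤k)

  -- By completeness, a vertex of `R` dominated by none of `v`, `a`, `b` would dominate all three,
  -- as they lie outside `R`.
  cover : ∀ {R v a b} (E : Enumeration R m) → v ∉ R → a ∉ R → b ∉ R → Undominated₃ v a b →
          Cover (dominated T E v) (dominated T E a) (dominated T E b)
  cover {R = R} {v} {a} {b} E v∉ a∉ b∉ un {i} _ with dec v (Enumeration.at E i) | dec a (Enumeration.at E i) | dec b (Enumeration.at E i)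
  ... | yes v≻ | _ | _ = x∈p∪q⁺ (inj₁ (∈-comprehension⁺ (λ i → dec v (Enumeration.at E i)) v≻))
  ... | no _ | yes a≻ | _ = x∈p∪q⁺ (inj₂ (x∈p∪q⁺ (inj₁ (∈-comprehension⁺ (λ i → dec a (Enumeration.at E i)) a≻))))
  ... | no _ | no _ | yes b≻ = x∈p∪q⁺ (inj₂ (x∈p∪q⁺ (inj₂ (∈-comprehension⁺ (λ i → dec b (Enumeration.at E i)) b≻))))
  ... | no v⊁ | no a⊁ | no b⊁ = ⊥-elim (un (at i) (beats v∉ v⊁) (beats a∉ a⊁) (beats b∉ b⊁))
    where
    open Enumeration E
    beats : ∀ {y} → y ∉ R → ¬ (y ≻ at i) → at i ≻ y
    beats y∉R y⊁ with complete (λ eq → y∉R (subst (_∈ R) eq (at∈ i)))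
    ... | inj₁ i≻y = i≻y
    ... | inj₂ y≻i = contradiction y≻i y⊁

  no-distinct-pair : ∀ f j → f ≡ 4 → ∀ {R₁ R₂} →
                     MinRet T (τ⊆ T (suc (f + suc j))) ⊤ R₁ → MinRet T (τ⊆ T (suc (f + suc j))) ⊤ R₂ → R₁ ≢ R₂ →
                     ∣ R₁ ∣ ≡ 6 → ∣ R₂ ∣ ≡ suc k → k ≤ 7 → ⊥
  no-distinct-pair f j f≡4 {R₁} {R₂} min₁ min₂ R₁≢R₂ ∣R₁∣ ∣R₂∣ k≤7 =
    undominatedTriad f j f≡4 min₂ (subst (Enumeration R₂) ∣R₂∣ (enumerate R₂)) k≤7
    λ { ((v , a , b , c) , (v∈ , a∈ , b∈ , c∈) , vab , vbc , vac) →
      resists resist (free v) (free a) (free b) (free c)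
        (cover E (out v∈) (out a∈) (out b∈) vab)
        (cover E (out v∈) (out b∈) (out c∈) vbc)
        (cover E (out v∈) (out a∈) (out c∈) vac) }
    where
    E₀ : Enumeration R₁ 6
    E₀ = subst (Enumeration R₁) ∣R₁∣ (enumerate R₁)
    open Enumeration E₀
    relabelling = resisting-relabelling (induced T at injective)
    E : Enumeration R₁ 6
    E = restrict E₀ (proj₁ relabelling) (λ {i} _ → at∈ i) id (λ _ → ∈⊤)
    -- Inducing twice agrees definitionally with inducing along the composite built by `restrict`,
    -- so the check on the relabelled tournament applies to `E`.
    resist : Resists (arcs (induced T (Enumeration.at E) (Enumeration.injective E))) f
    resist = subst (Resists _) (sym f≡4) (proj₂ relabelling)
    free : ∀ x → ChainFree (allChains (arcs (induced T (Enumeration.at E) (Enumeration.injective E))) f) (dominated T E x)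
    free = dominated-chainFree T E f j min₁
    out : ∀ {x} → x ∈ R₂ → x ∉ R₁
    out x∈₂ x∈₁ = minimalRetentive-disjoint T {f + suc j} min₁ min₂ R₁≢R₂ x∈₁ x∈₂

-- Of the fuel `n`, one unit is spent on the first vertex of a chain, four are for the rest, and
-- `suc j` remains positive. Six vertices in the first set guarantee this much.
fuel : 6 ≤ n → ∃ λ f → ∃ λ j → f ≡ 4 × n ≡ suc (f + suc j)
fuel 6≤n with m≤n⇒∃[o]m+o≡n 6≤n
... | j , refl = 4 , j , refl , refl

theorem6 : (n : ℕ) (T : Tournament n) (R₁ R₂ : Subset n) →
    MinimalTauRetentive T R₁ → MinimalTauRetentive T R₂ → ¬ (R₁ ≡ R₂) →
    ∣ R₁ ∣ ≡ 6 → (∣ R₂ ∣ ≡ 6 ⊎ ∣ R₂ ∣ ≡ 7 ⊎ ∣ R₂ ∣ ≡ 8) → ⊥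
theorem6 n T R₁ R₂ min₁ min₂ R₁≢R₂ ∣R₁∣ =
  [ conclude (≤-trans (n≤1+n 5) (n≤1+n 6)) , [ conclude (n≤1+n 6) , conclude ≤-refl ]′ ]′
  where
  conclude : k ≤ 7 → ∣ R₂ ∣ ≡ suc k → ⊥
  conclude k≤7 ∣R₂∣ with fuel (subst (_≤ n) ∣R₁∣ (∣p∣≤n R₁))
  ... | f , j , f≡4 , n≡ =
    no-distinct-pair T f j f≡4 (subst (λ l → MinRet T (τ⊆ T l) ⊤ R₁) n≡ min₁)
      (subst (λ l → MinRet T (τ⊆ T l) ⊤ R₂) n≡ min₂) R₁≢R₂ ∣R₁∣ ∣R₂∣ k≤7
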